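{- For every integer $n\ge 2$, with $m_i=\left\lfloor \log_2\left(\frac{i-1}{4}\right)\right\rfloor$, $$2\cdot\sum_{i=\lceil n/2\rceil+1}^{n}\left(\left\lfloor\frac{i-1}{2}\right\rfloor+\left\lfloor\frac{n-i}{2}\right\rfloor\right)!\cdot\prod_{j=1}^{m_i}(2^{j-1})!\ \le\ a_n .$$
   Context: Places $1,\dots,n$ stand in a row; neighbouring places have distance $1$. At any time at which at least one place is occupied, the distance of an empty place $x$ is $\min|x-y|$ over all occupied places $y$. Persons arrive one after another and each occupies one empty place. Politeness rule: every person except the first (who chooses freely) occupies one of the empty places whose distance is maximal among all empty places at that time. $a_n$ is the number of sequences $(x_1,\dots,x_n)$ (permutations of $\{1,\dots,n\}$, $x_t$ being the place taken by the $t$-th person) in which $n$ persons fill all $n$ places obeying the politeness rule. A product $\prod_{j=1}^{m}$ with $m\le 0$ is empty and equals $1$. -}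

module Defs where

open import Data.Fin using (Fin; toℕ)
open import Data.Fin.Properties using (_≟_; all?)
open import Data.Integer as ℤ using (ℤ; +_; -[1+_])
open import Data.List using (List; []; _∷_; map; filter; length; allFin; applyUpTo; cartesianProductWith)
import Data.List.Membership.DecPropositional as DecMembership
open import Data.List.Membership.Propositional using (_∉_)
open import Data.List.NonEmpty as List⁺ using (List⁺; _∷⁺_; [_])
open import Data.Nat using (ℕ; zero; suc; _+_; _∸_; _⊓_; _≤_; ∣_-_∣)
open import Data.Nat.ListAction using (sum; product)
open import Data.Nat.Logarithm using (⌊log₂_⌋)
open import Data.Nat.Properties using (_≤?_)
open import Data.Product using (_×_)
open import Data.Unit using (⊤; tt)
open import Data.Vec using (Vec; []; _∷_)
open import Relation.Nullary using (Dec; yes; ¬?; _×-dec_; _→-dec_)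

-- The places 1, …, n are the elements of Fin n (place p is the element with
-- toℕ = p ∸ 1).  The occupied places are kept as a nonempty list, so that the
-- minimum below is over a nonempty collection.

distance : ∀ {n} → List⁺ (Fin n) → Fin n → ℕ
distance occ x = List⁺.foldr₁ _⊓_ (List⁺.map (λ y → ∣ toℕ x - toℕ y ∣) occ)

Empty : ∀ {n} → List⁺ (Fin n) → Fin n → Set
Empty occ x = x ∉ List⁺.toList occ

PoliteChoice : ∀ {n} → List⁺ (Fin n) → Fin n → Set
PoliteChoice occ x = Empty occ x × (∀ z → Empty occ z → distance occ z ≤ distance occ x)

PoliteAfter : ∀ {n k} → List⁺ (Fin n) → Vec (Fin n) k → Set
PoliteAfter occ []       = ⊤
PoliteAfter occ (x ∷ xs) = PoliteChoice occ x × PoliteAfter (x ∷⁺ occ) xs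

-- Every person takes an empty place, so the entries are pairwise distinct; a
-- polite Vec (Fin n) n is therefore a permutation of the places.

Polite : ∀ {n k} → Vec (Fin n) k → Set
Polite []       = ⊤
Polite (x ∷ xs) = PoliteAfter [ x ] xs

empty? : ∀ {n} (occ : List⁺ (Fin n)) (x : Fin n) → Dec (Empty occ x)
empty? occ x = ¬? (x ∈? List⁺.toList occ)
  where open DecMembership _≟_ using (_∈?_)

politeChoice? : ∀ {n} (occ : List⁺ (Fin n)) (x : Fin n) → Dec (PoliteChoice occ x)
politeChoice? occ x =
  empty? occ x ×-dec all? (λ z → empty? occ z →-dec (distance occ z ≤? distance occ x))

politeAfter? : ∀ {n k} (occ : List⁺ (Fin n)) (xs : Vec (Fin n) k) → Dec (PoliteAfter occ xs)
politeAfter? occ []       = yes tt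
politeAfter? occ (x ∷ xs) = politeChoice? occ x ×-dec politeAfter? (x ∷⁺ occ) xs

polite? : ∀ {n k} (xs : Vec (Fin n) k) → Dec (Polite xs)
polite? []       = yes tt
polite? (x ∷ xs) = politeAfter? [ x ] xs

-- Every sequence of length k over Fin n, each listed exactly once.

sequences : ∀ n k → List (Vec (Fin n) k)
sequences n zero    = [] ∷ []
sequences n (suc k) = cartesianProductWith _∷_ (allFin n) (sequences n k)

a : ℕ → ℕ
a n = length (filter polite? (sequences n n))

-- ∑[ p ⋯ q ] f = f p + f (p + 1) + … + f q, which is 0 when q < p.

∑[_⋯_]_ : ℕ → ℕ → (ℕ → ℕ) → ℕ
∑[ p ⋯ q ] f = sum (map f (applyUpTo (λ k → p + k) (suc q ∸ p)))

-- ∏[1⋯ m ] f = f 1 * … * f m, which is 1 when m ≤ 0.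

∏[1⋯_]_ : ℤ → (ℕ → ℕ) → ℕ
∏[1⋯ + m      ] f = product (map f (applyUpTo suc m))
∏[1⋯ -[1+ _ ] ] f = 1

-- ⌊log₂ (x / 4)⌋ for x ≥ 1, an integer that is negative for x < 4:
-- log₂ (x / 4) = log₂ x − 2, and the floor commutes with the integer shift.
-- The value at x = 0 is meaningless.

⌊log₂_/4⌋ : ℕ → ℤ
⌊log₂ x /4⌋ = + ⌊log₂ x ⌋ ℤ.- + 2

{-# OPTIONS --safe #-}

-- Idea.  Label the places so that (separated) two places with labels ≥ q are at
-- distance ≥ q, and (dense) every place is within q of one whose label exceeds q.
-- Then every order of occupation with non-increasing labels is polite, and the
-- number of these orders is the product of the factorials of the multiplicities.
-- If the first person sits with l places on one side and r on the other, such
-- a labelling gives n to that place, l and r to the ends of the row, and then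
-- repeatedly halves every gap, labelling its midpoint with the shorter half.
-- The label 1 occurs at least ⌊l/2⌋ + ⌊r/2⌋ times.  The 2^j gaps at depth j of the
-- halving of d ∈ {l , r} have only the two labels ⌊d/2^(j+1)⌋ and its successor,
-- so one of the two occurs at least 2^(j-1) times.  The factor 2 comes from the
-- mirror image of the first place.

module Submission where

open import Defs
open import Data.Nat using (ℕ; suc; _+_; _*_; _∸_; _^_; _≤_; ⌊_/2⌋; ⌈_/2⌉; _!)
open import Data.Bool using (if_then_else_)
open import Data.Fin as Fin using (Fin; toℕ; fromℕ<)
open import Data.Fin.Properties as Fin using (toℕ-fromℕ<; toℕ-injective; toℕ≤pred[n])
open import Data.Integer as ℤ using ()
open import Data.List using (List; []; _∷_; _++_; map; filter; length; reverse; tabulate; allFin; applyUpTo; applyDownFrom; cartesianProductWith)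
import Data.List.Membership.DecPropositional as DecMembership
open import Data.List.Membership.Propositional using (_∈_; lose)
open import Data.List.Membership.Propositional.Properties using (∈-allFin)
open import Data.List.NonEmpty as List⁺ using (List⁺; _∷⁺_; [_])
open import Data.List.Properties using (filter-++; length-++; filter-all; length-tabulate; filter-some; map-applyUpTo; map-tabulate; reverse-applyUpTo)
open import Data.List.Relation.Binary.Permutation.Propositional.Properties using (↭-reverse)
open import Data.List.Relation.Unary.All as All using ()
open import Data.List.Relation.Unary.AllPairs using (_∷_)
open import Data.List.Relation.Unary.Any using (here; there)
open import Data.List.Relation.Unary.Unique.Propositional using (Unique)
open import Data.List.Relation.Unary.Unique.Propositional.Properties using (allFin⁺)
open import Data.Nat using (zero; _<_; z≤n; s≤s; s≤s⁻¹; _⊔_; ∣_-_∣)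
open import Data.Nat.Induction using (<-rec)
open import Data.Nat.ListAction using (sum; product)
open import Data.Nat.ListAction.Properties using (sum-↭)
open import Data.Nat.Logarithm using (⌊log₂_⌋; ⌊log₂⌊n/2⌋⌋≡⌊log₂n⌋∸1)
open import Data.Nat.Properties
open import Data.Nat.Solver using (module +-*-Solver)
open import Data.Product using (_×_; _,_; ∃; proj₁; proj₂; map₁; map₂)
open import Data.Sum using (_⊎_; inj₁; inj₂; [_,_]′)
open import Data.Unit using (tt)
open import Data.Vec using (_∷_)
open import Function using (_∘_; id; const)
open import Relation.Binary.Definitions using (tri<; tri≈; tri>)
open import Relation.Binary.PropositionalEquality hiding ([_])
open import Relation.Nullary using (yes; no; ¬_; contradiction; does; _×-dec_)
open import Relation.Nullary.Decidable using (dec-true; dec-false)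
open import Relation.Unary using (Decidable)
open import Relation.Unary.Properties using (U?)

-- Orders of occupation with non-increasing labels

count : ∀ {A : Set} {P : A → Set} → Decidable P → List A → ℕ
count P? xs = length (filter P? xs)

module _ {A : Set} {P Q : A → Set} (P? : Decidable P) (Q? : Decidable Q) where

  count-mono : ∀ xs → (∀ {x} → x ∈ xs → P x → Q x) → count P? xs ≤ count Q? xs
  count-mono []       _   = z≤n
  count-mono (x ∷ xs) P⇒Q with P? x | Q? x | count-mono xs (P⇒Q ∘ there)
  ... | yes _ | yes _ | ih = s≤s ih
  ... | yes p | no ¬q | ih = contradiction (P⇒Q (here refl) p) ¬q
  ... | no _  | yes _ | ih = m≤n⇒m≤1+n ih
  ... | no _  | no _  | ih = ih

module _ {A : Set} {P Q : A → Set} (P? : Decidable P) (Q? : Decidable Q) where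

  count-cong : ∀ xs → (∀ {x} → x ∈ xs → P x → Q x) → (∀ {x} → x ∈ xs → Q x → P x) →
               count P? xs ≡ count Q? xs
  count-cong xs P⇒Q Q⇒P = ≤-antisym (count-mono P? Q? xs P⇒Q) (count-mono Q? P? xs Q⇒P)

  count-delete : ∀ {x xs} → Unique xs → x ∈ xs → P x → ¬ Q x →
                 (∀ {y} → Q y → P y) → (∀ {y} → y ≢ x → P y → Q y) →
                 count P? xs ≡ suc (count Q? xs)
  count-delete {xs = x ∷ xs} (x∉xs ∷ _) (here refl) p ¬q Q⇒P P⇒Q with P? x | Q? x
  ... | no ¬p | _     = contradiction p ¬p
  ... | yes _ | yes q = contradiction q ¬q
  ... | yes _ | no _  = cong suc (count-cong xs
          (λ y∈xs → P⇒Q (λ y≡x → All.lookup x∉xs y∈xs (sym y≡x))) (λ _ → Q⇒P))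
  count-delete {xs = y ∷ xs} (y∉xs ∷ u) (there x∈xs) p ¬q Q⇒P P⇒Q
    with P? y | Q? y | count-delete u x∈xs p ¬q Q⇒P P⇒Q
  ... | yes _  | yes _ | ih = cong suc ih
  ... | yes py | no ¬r | ih = contradiction (P⇒Q (All.lookup y∉xs x∈xs) py) ¬r
  ... | no ¬py | yes r | ih = contradiction (Q⇒P r) ¬py
  ... | no _   | no _  | ih = ih

module _ {A : Set} {P : A → Set} (P? : Decidable P) where

  count≡0 : ∀ {x xs} → count P? xs ≡ 0 → x ∈ xs → ¬ P x
  count≡0 eq x∈xs p = <⇒≢ (filter-some P? (lose x∈xs p)) (sym eq)

  count-none : ∀ xs → (∀ {x} → x ∈ xs → ¬ P x) → count P? xs ≡ 0
  count-none []       _  = refl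
  count-none (x ∷ xs) ¬P with P? x
  ... | yes p = contradiction p (¬P (here refl))
  ... | no _  = count-none xs (¬P ∘ there)

  count-++ : ∀ xs ys → count P? (xs ++ ys) ≡ count P? xs + count P? ys
  count-++ xs ys = trans (cong length (filter-++ P? xs ys)) (length-++ (filter P? xs))

  count-map : ∀ {B : Set} (f : B → A) xs → count P? (map f xs) ≡ count (P? ∘ f) xs
  count-map f []       = refl
  count-map f (x ∷ xs) with P? (f x)
  ... | yes _ = cong suc (count-map f xs)
  ... | no _  = count-map f xs

  count-cartesianProductWith : ∀ {B C : Set} (f : B → C → A) xs ys →
    count P? (cartesianProductWith f xs ys) ≡ sum (map (λ x → count (P? ∘ f x) ys) xs)
  count-cartesianProductWith f []       ys = refl
  count-cartesianProductWith f (x ∷ xs) ys = trans (count-++ (map (f x) ys) _)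
    (cong₂ _+_ (count-map (f x) ys) (count-cartesianProductWith f xs ys))

  count*≤sum : ∀ m (F : A → ℕ) → (∀ {x} → P x → m ≤ F x) → ∀ xs → count P? xs * m ≤ sum (map F xs)
  count*≤sum m F m≤F []       = z≤n
  count*≤sum m F m≤F (x ∷ xs) with P? x
  ... | yes p = +-mono-≤ (m≤F p) (count*≤sum m F m≤F xs)
  ... | no _  = ≤-trans (count*≤sum m F m≤F xs) (m≤n+m _ (F x))

module _ {n : ℕ} where

  distance-≥ : ∀ {m} y ys (x : Fin n) → (∀ {z} → z ∈ y ∷ ys → m ≤ ∣ toℕ x - toℕ z ∣) →
               m ≤ distance (y List⁺.∷ ys) x
  distance-≥ y []       x far = far (here refl)
  distance-≥ y (z ∷ zs) x far = ⊓-glb (far (here refl)) (distance-≥ z zs x (far ∘ there))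

  distance-≤ : ∀ y ys (x : Fin n) {z} → z ∈ y ∷ ys → distance (y List⁺.∷ ys) x ≤ ∣ toℕ x - toℕ z ∣
  distance-≤ y []       x (here refl) = ≤-refl
  distance-≤ y (z ∷ zs) x (here refl) = m⊓n≤m _ _
  distance-≤ y (z ∷ zs) x (there z∈)  = ≤-trans (m⊓n≤n _ _) (distance-≤ z zs x z∈)

  continuations : List⁺ (Fin n) → ℕ → ℕ
  continuations occ k = count (politeAfter? occ) (sequences n k)

  -- Sorting the sequences by their next entry turns the count into a sum over all places, of which
  -- only the terms with `x` in `S` are kept.
  continuations-suc : ∀ {occ k m} {S : Fin n → Set} (S? : Decidable S) →
    (∀ {x} → S x → PoliteChoice occ x) →
    (∀ {x} → S x → m ≤ continuations (x ∷⁺ occ) k) →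
    count S? (allFin n) * m ≤ continuations occ (suc k)
  continuations-suc {occ} {k} {m} S? polite bound = begin
    count S? (allFin n) * m
      ≤⟨ count*≤sum S? m _ (λ s → ≤-trans (bound s)
           (count-mono (politeAfter? _) _ (sequences n k) (λ _ → polite s ,_))) (allFin n) ⟩
    sum (map (λ x → count (politeAfter? occ ∘ (x ∷_)) (sequences n k)) (allFin n))
      ≡⟨ count-cartesianProductWith (politeAfter? occ) _∷_ (allFin n) (sequences n k) ⟨
    continuations occ (suc k) ∎
    where open ≤-Reasoning

  empty-∷ : ∀ {occ x} → Empty occ x →
            count (empty? occ) (allFin n) ≡ suc (count (empty? (x ∷⁺ occ)) (allFin n))
  empty-∷ {x = x} x∉ = count-delete (empty? _) (empty? _) (allFin⁺ n) (∈-allFin x) x∉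
    (λ x∉′ → x∉′ (here refl)) (_∘ there)
    (λ y≢x y∉ → λ { (here y≡x) → y≢x y≡x ; (there y∈) → y∉ y∈ })

  -- In the labellings used below the largest label is `n`, that of the first place; hence the
  -- restriction `q < n` in `dense`.
  record Priority (ℓ : Fin n → ℕ) : Set where
    field
      separated : ∀ {q x y} → x ≢ y → q ≤ ℓ x → q ≤ ℓ y → q ≤ ∣ toℕ x - toℕ y ∣
      dense     : ∀ {q} → q < n → (z : Fin n) → ∃ λ y → q < ℓ y × ∣ toℕ z - toℕ y ∣ ≤ q

  multiplicity : (Fin n → ℕ) → ℕ → ℕ
  multiplicity ℓ q = count (λ x → ℓ x ≟ q) (allFin n)

-- The number of orders, by non-increasing label, of the places with labels < q.
orderings : (ℕ → ℕ) → ℕ → ℕ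
orderings N zero    = 1
orderings N (suc q) = N q ! * orderings N q

module _ {n : ℕ} (ℓ : Fin n → ℕ) where

  Vacant : ℕ → List⁺ (Fin n) → Fin n → Set
  Vacant q occ x = ℓ x ≡ q × Empty occ x

  vacant? : ∀ q occ → Decidable (Vacant q occ)
  vacant? q occ x = (ℓ x ≟ q) ×-dec empty? occ x

  -- The invariant while level `q` is being occupied: any part of that level may already be taken.
  Filled : ℕ → List⁺ (Fin n) → Set
  Filled q occ = (∀ {y} → q < ℓ y → y ∈ List⁺.toList occ) × (∀ {y} → y ∈ List⁺.toList occ → q ≤ ℓ y)

  filled-∷ : ∀ {q occ x} → Filled q occ → Vacant q occ x → Filled q (x ∷⁺ occ)
  filled-∷ (upper , lower) (refl , _) = there ∘ upper , λ { (here refl) → ≤-refl ; (there y∈) → lower y∈ }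

  vacant-∷ : ∀ {q occ x} → Vacant q occ x →
             count (vacant? q occ) (allFin n) ≡ suc (count (vacant? q (x ∷⁺ occ)) (allFin n))
  vacant-∷ {x = x} v = count-delete (vacant? _ _) (vacant? _ _) (allFin⁺ n) (∈-allFin x) v
    (λ (_ , x∉) → x∉ (here refl)) (λ (eq , y∉) → eq , y∉ ∘ there)
    (λ y≢x (eq , y∉) → eq , λ { (here y≡x) → y≢x y≡x ; (there y∈) → y∉ y∈ })

module _ {n : ℕ} (ℓ : Fin n → ℕ) (priority : Priority ℓ) where

  open Priority priority
  open DecMembership (Fin._≟_ {n}) using (_∈?_)

  -- By `dense` every place is within `q` of an occupied one, so no distance exceeds `q`; by
  -- `separated` the place `x`, labelled `q`, is at distance at least `q` from all occupied ones.
  filled-polite : ∀ {q occ x} → q < n → Filled ℓ q occ → Vacant ℓ q occ x → PoliteChoice occ x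
  filled-polite {q} {occ} {x} q<n (upper , lower) (refl , x∉occ) = x∉occ , λ z _ →
    let (y , q<ℓy , z~y) = dense q<n z in
    ≤-trans (≤-trans (distance-≤ _ _ z (upper q<ℓy)) z~y)
      (distance-≥ _ _ x (λ y∈occ → separated (λ { refl → x∉occ y∈occ }) ≤-refl (lower y∈occ)))

  -- Lexicographic induction on `q` and `c`. Each of the `c` vacant places of level `q` may be taken
  -- next, which builds up `c !`; an exhausted level hands over to the one below.
  filled⇒continuations : ∀ q c k occ → q < n → Filled ℓ q occ →
    count (vacant? ℓ q occ) (allFin n) ≡ c → count (empty? occ) (allFin n) ≡ k →
    c ! * orderings (multiplicity ℓ) q ≤ continuations occ k
  -- With level 0 exhausted no place is empty, so `k` is 0 and both sides are 1.
  filled⇒continuations zero zero k occ q<n (upper , _) c≡ k≡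
    rewrite sym k≡ | count-none (empty? occ) (allFin n) λ {x} _ x∉ →
      count≡0 (vacant? ℓ 0 occ) c≡ (∈-allFin x)
        (n≤0⇒n≡0 (≮⇒≥ (x∉ ∘ upper)) , x∉) = ≤-refl
  -- All occupied places have labels above `q`, so level `q` starts with its full multiplicity
  -- vacant.
  filled⇒continuations (suc q) zero k occ q<n (upper , lower) c≡ k≡ = begin
    1 * (multiplicity ℓ q ! * orderings (multiplicity ℓ) q) ≡⟨ *-identityˡ _ ⟩
    multiplicity ℓ q ! * orderings (multiplicity ℓ) q
      ≤⟨ filled⇒continuations q (multiplicity ℓ q) k occ (<⇒≤ q<n)
           (upper′ , <⇒≤ ∘ lower) vacant≡N k≡ ⟩
    continuations occ k         ∎
    where
    open ≤-Reasoning
    upper′ : ∀ {y} → q < ℓ y → y ∈ List⁺.toList occ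
    upper′ {y} q<ℓy with y ∈? List⁺.toList occ
    ... | yes y∈ = y∈
    ... | no  y∉ = contradiction (≤-antisym (≮⇒≥ (y∉ ∘ upper)) q<ℓy , y∉)
                     (count≡0 (vacant? ℓ (suc q) occ) c≡ (∈-allFin y))
    vacant≡N : count (vacant? ℓ q occ) (allFin n) ≡ multiplicity ℓ q
    vacant≡N = count-cong (vacant? ℓ q occ) _ (allFin n) (λ _ → proj₁)
      (λ { _ refl → refl , λ y∈ → <-irrefl refl (lower y∈) })
  filled⇒continuations q (suc c) zero occ q<n filled c≡ k≡ =
    contradiction (≤-trans (≤-reflexive (sym c≡)) (≤-trans
      (count-mono (vacant? ℓ q occ) (empty? occ) (allFin n) (λ _ → proj₂)) (≤-reflexive k≡))) λ ()
  filled⇒continuations q (suc c) (suc k) occ q<n filled c≡ k≡ = begin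
    suc c * c ! * orderings (multiplicity ℓ) q        ≡⟨ *-assoc (suc c) (c !) _ ⟩
    suc c * (c ! * orderings (multiplicity ℓ) q)      ≡⟨ cong (_* (c ! * orderings (multiplicity ℓ) q)) c≡ ⟨
    count (vacant? ℓ q occ) (allFin n) * (c ! * orderings (multiplicity ℓ) q)
      ≤⟨ continuations-suc (vacant? ℓ q occ) (filled-polite q<n filled) (λ v →
           filled⇒continuations q c k _ q<n (filled-∷ ℓ filled v)
             (suc-injective (trans (sym (vacant-∷ ℓ v)) c≡))
             (suc-injective (trans (sym (empty-∷ (proj₂ v))) k≡))) ⟩
    continuations occ (suc k)          ∎
    where open ≤-Reasoning

-- The row has `suc n` places and `p` alone carries the label `suc n`, so after the first person
-- level `n` is in progress and still untouched.
orderings≤continuations : ∀ {n} (ℓ : Fin (suc n) → ℕ) → Priority ℓ → ∀ {p} → ℓ p ≡ suc n →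
  orderings (multiplicity ℓ) (suc n) ≤ continuations [ p ] n
orderings≤continuations {n} ℓ priority {p} ℓp =
  filled⇒continuations ℓ priority n (multiplicity ℓ n) n [ p ] ≤-refl (upper , lower)
    (count-cong (vacant? ℓ n [ p ]) (λ x → ℓ x ≟ n) (allFin (suc n)) (λ _ → proj₁)
      (λ { _ eq → eq , λ { (here refl) → 1+n≢n (trans (sym ℓp) eq) } }))
    (suc-injective (begin
      suc (count (empty? [ p ]) (allFin (suc n)))
        ≡⟨ count-delete U? (empty? [ p ]) (allFin⁺ _) (∈-allFin p) tt
             (λ p∉ → p∉ (here refl)) (λ _ → tt) (λ { y≢p _ (here y≡p) → y≢p y≡p }) ⟨
      count U? (allFin (suc n))
        ≡⟨ cong length (filter-all U? (All.universal (λ _ → tt) (allFin (suc n)))) ⟩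
      length (allFin (suc n)) ≡⟨ length-tabulate id ⟩
      suc n                   ∎))
  where
  open Priority priority
  open ≡-Reasoning
  upper : ∀ {y} → n < ℓ y → y ∈ p ∷ []
  upper {y} n<ℓy with y Fin.≟ p
  ... | yes y≡p = here y≡p
  -- A second label `suc n` would force a distance of at least `suc n`, but distances in the row are
  -- at most `n`.
  ... | no  y≢p = contradiction (separated y≢p n<ℓy (≤-reflexive (sym ℓp)))
    (<⇒≱ (s≤s (≤-trans (∣m-n∣≤m⊔n (toℕ y) (toℕ p)) (⊔-lub (Fin.toℕ≤pred[n] y) (Fin.toℕ≤pred[n] p)))))
  lower : ∀ {y} → y ∈ p ∷ [] → n ≤ ℓ y
  lower (here refl) = ≤-trans (n≤1+n n) (≤-reflexive (sym ℓp))

-- Labellings by repeated bisection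

-- The interior of the gap from a to b is labelled by repeated bisection; f is
-- unconstrained at a and b.
data Bisected (f : ℕ → ℕ) : ℕ → ℕ → Set where
  leaf : ∀ {a} → Bisected f a (suc a)
  node : ∀ {a m b} k → a + f m ≡ m → m + k ≡ b → f m ≤ k → k ≤ suc (f m) →
         Bisected f a m → Bisected f m b → Bisected f a b

bisected⇒< : ∀ {f a b} → Bisected f a b → a < b
bisected⇒< leaf                = ≤-refl
bisected⇒< (node _ _ _ _ _ s t) = <-trans (bisected⇒< s) (bisected⇒< t)

bisected-cong : ∀ {f g a b} → (∀ {x} → a < x → x < b → f x ≡ g x) → Bisected f a b → Bisected g a b
bisected-cong f≈g leaf = leaf
bisected-cong {a = a} f≈g (node {m = m} k a+h≡m m+k≡b h≤k k≤1+h s t) = node k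
  (subst (λ h → a + h ≡ m) eq a+h≡m) m+k≡b (subst (_≤ k) eq h≤k) (subst (λ h → k ≤ suc h) eq k≤1+h)
  (bisected-cong (λ a<x x<m → f≈g a<x (<-trans x<m (bisected⇒< t))) s)
  (bisected-cong (λ m<x x<b → f≈g (<-trans (bisected⇒< s) m<x) x<b) t)
  where eq = f≈g (bisected⇒< s) (bisected⇒< t)

-- `x` is the midpoint of some subgap, and `f x` is the shorter half of that subgap.
bisected-reach : ∀ {f a b x} → Bisected f a b → a < x → x < b → a + f x ≤ x × x + f x ≤ b
bisected-reach leaf a<x x<b = contradiction x<b (≤⇒≯ a<x)
bisected-reach {x = x} (node {m = m} k a+h≡m m+k≡b h≤k _ s t) a<x x<b with <-cmp x m
... | tri< x<m _ _ = map₂ (λ x+fx≤m → ≤-trans x+fx≤m (<⇒≤ (bisected⇒< t))) (bisected-reach s a<x x<m)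
... | tri≈ _ refl _ = ≤-reflexive a+h≡m , ≤-trans (+-monoʳ-≤ m h≤k) (≤-reflexive m+k≡b)
... | tri> _ _ m<x = map₁ (≤-trans (+-monoˡ-≤ _ (<⇒≤ (bisected⇒< s)))) (bisected-reach t m<x x<b)

-- If the midpoint lies strictly between `x` and `y`, an interior one of the two has its label
-- bounded by its distance to the midpoint; otherwise both lie in one half. The pair of ends is
-- excepted because `f` is free there; when it occurs in a half, the node above settles it, since
-- one of the two is then its midpoint.
bisected-separated : ∀ {f a b x y} → Bisected f a b → a ≤ x → x < y → y ≤ b →
                     (x + f x ≤ y ⊎ x + f y ≤ y) ⊎ (x ≡ a × y ≡ b)
bisected-separated leaf a≤x x<y y≤b =
  inj₂ (≤-antisym (s≤s⁻¹ (≤-trans x<y y≤b)) a≤x , ≤-antisym y≤b (≤-trans (s≤s a≤x) x<y))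
bisected-separated {f} {x = x} {y} (node {m = m} k a+h≡m m+k≡b h≤k _ s t) a≤x x<y y≤b
  with y ≤? m | m ≤? x
... | yes y≤m | _ = [ inj₁ , (λ { (refl , refl) → inj₁ (inj₂ (≤-reflexive a+h≡m)) }) ]′
                      (bisected-separated s a≤x x<y y≤m)
... | no _ | yes m≤x =
  [ inj₁ , (λ { (refl , refl) → inj₁ (inj₁ (≤-trans (+-monoʳ-≤ m h≤k) (≤-reflexive m+k≡b))) }) ]′
    (bisected-separated t m≤x x<y y≤b)
... | no y≰m | no m≰x with m≤n⇒m<n∨m≡n a≤x | m≤n⇒m<n∨m≡n y≤b
...   | inj₁ a<x  | _         =
  inj₁ (inj₁ (≤-trans (proj₂ (bisected-reach s a<x (≰⇒> m≰x))) (<⇒≤ (≰⇒> y≰m))))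
...   | inj₂ refl | inj₁ y<b  =
  inj₁ (inj₂ (≤-trans (+-monoˡ-≤ (f y) (<⇒≤ (bisected⇒< s))) (proj₁ (bisected-reach t (≰⇒> y≰m) y<b))))
...   | inj₂ refl | inj₂ refl = inj₂ (refl , refl)

∣-∣-≤ : ∀ {x y q} → x ≤ y + q → y ≤ x + q → ∣ x - y ∣ ≤ q
∣-∣-≤ {x} {y} x≤ y≤ with ∣m-n∣≡[m∸n]∨[n∸m] x y
... | inj₁ eq rewrite eq = m≤n+o⇒m∸n≤o x y x≤
... | inj₂ eq rewrite eq = m≤n+o⇒m∸n≤o y x y≤

-- If the midpoint has a label above `q`, the half containing `z` again has both ends above `q`.
-- Otherwise the gap is so short that one of its ends is near enough.
bisected-dense : ∀ {f a b q z} → Bisected f a b → q < f a → q < f b → a ≤ z → z ≤ b →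
                 ∃ λ y → y ≤ b × q < f y × ∣ z - y ∣ ≤ q
bisected-dense {f} {q = q} {z = z} leaf q<fa q<fb a≤z z≤b with m≤n⇒m<n∨m≡n a≤z
... | inj₁ a<z  = z , z≤b , subst (λ x → q < f x) (≤-antisym a<z z≤b) q<fb ,
  subst (_≤ _) (sym (∣n-n∣≡0 z)) z≤n
... | inj₂ refl = z , z≤b , q<fa , subst (_≤ _) (sym (∣n-n∣≡0 z)) z≤n
bisected-dense {f} {a} {b} {q} {z} (node {m = m} k a+h≡m m+k≡b _ k≤1+h s t) q<fa q<fb a≤z z≤b
  with q <? f m | z ≤? m
... | yes q<h | yes z≤m = let (y , y≤m , r) = bisected-dense s q<fa q<h a≤z z≤m in
                          y , ≤-trans y≤m (<⇒≤ (bisected⇒< t)) , r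
... | yes q<h | no z≰m  = bisected-dense t q<h q<fb (<⇒≤ (≰⇒> z≰m)) z≤b
... | no q≮h  | yes z≤m = a , <⇒≤ (<-trans (bisected⇒< s) (bisected⇒< t)) , q<fa ,
  ∣-∣-≤ (≤-trans z≤m (≤-trans (≤-reflexive (sym a+h≡m)) (+-monoʳ-≤ a (≮⇒≥ q≮h)))) (m≤n⇒m≤n+o q a≤z)
-- The right half may have length `q + 1`; the strict inequality `m < z` makes up for the extra 1.
... | no q≮h  | no z≰m  = b , ≤-refl , q<fb , ∣-∣-≤ (m≤n⇒m≤n+o q z≤b) (begin
  b           ≡⟨ m+k≡b ⟨
  m + k       ≤⟨ +-monoʳ-≤ m (≤-trans k≤1+h (s≤s (≮⇒≥ q≮h))) ⟩
  m + suc q   ≡⟨ +-suc m q ⟩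
  suc (m + q) ≤⟨ +-monoˡ-≤ q (≰⇒> z≰m) ⟩
  z + q       ∎)
  where open ≤-Reasoning

_[_≔_] : (ℕ → ℕ) → ℕ → ℕ → ℕ → ℕ
(f [ m ≔ v ]) x = if does (x ≟ m) then v else f x

≔-hit : ∀ f m v → (f [ m ≔ v ]) m ≡ v
≔-hit f m v = cong (if_then v else f m) (dec-true (m ≟ m) refl)

≔-miss : ∀ f m v {x} → x ≢ m → (f [ m ≔ v ]) x ≡ f x
≔-miss f m v {x} x≢m = cong (if_then v else f x) (dec-false (x ≟ m) x≢m)

-- `f` is altered only strictly inside the gap, so that gaps sharing an end can be treated one after
-- the other. The guard `0 < δ` reflects that `Bisected` has no gap of length 0.
Bisection : (ℕ → ℕ) → ℕ → ℕ → Set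
Bisection f a δ = ∃ λ g → (0 < δ → Bisected g a (a + δ)) × (∀ {x} → x ≤ a ⊎ a + δ ≤ x → g x ≡ f x)

-- The midpoint is labelled first, then the left half, then the right half. Neither later change
-- touches the midpoint, and the last one does not touch the left half.
bisection-+ : ∀ {h k} → 0 < h → h ≤ k → k ≤ suc h →
              (∀ f a → Bisection f a h) → (∀ f a → Bisection f a k) → ∀ f a → Bisection f a (h + k)
bisection-+ {h} {k} 0<h h≤k k≤1+h left right f a
  with (g₁ , B₁ , out₁) ← left (f [ a + h ≔ h ]) a
  with (g₂ , B₂ , out₂) ← right g₁ (a + h) =
  g₂ ,
  (λ _ → subst (Bisected g₂ a) (+-assoc a h k) (node k (cong (a +_) mid) refl (subst (_≤ k) (sym mid) h≤k)
     (subst (λ h → k ≤ suc h) (sym mid) k≤1+h)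
     (bisected-cong (λ _ x<m → sym (out₂ (inj₁ (<⇒≤ x<m)))) (B₁ 0<h))
     (B₂ (≤-trans 0<h h≤k)))) ,
  λ where
    (inj₁ x≤a) → trans (out₂ (inj₁ (≤-trans x≤a (m≤m+n a h)))) (trans (out₁ (inj₁ x≤a))
      (≔-miss f (a + h) h (<⇒≢ (≤-<-trans x≤a (m<m+n a 0<h)))))
    (inj₂ b≤x) → let b≤x′ = ≤-trans (≤-reflexive (+-assoc a h k)) b≤x in
      trans (out₂ (inj₂ b≤x′)) (trans (out₁ (inj₂ (≤-trans (m≤m+n (a + h) k) b≤x′)))
      (≔-miss f (a + h) h (>⇒≢ (<-≤-trans (m<m+n (a + h) (≤-trans 0<h h≤k)) b≤x′))))
  where
  mid : g₂ (a + h) ≡ h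
  mid = trans (out₂ (inj₁ ≤-refl)) (trans (out₁ (inj₂ ≤-refl)) (≔-hit f (a + h) h))

bisection : ∀ δ f a → Bisection f a δ
bisection = <-rec _ step
  where
  step : ∀ δ → (∀ {δ′} → δ′ < δ → ∀ f a → Bisection f a δ′) → ∀ f a → Bisection f a δ
  step zero          _   f a = f , (λ ()) , λ _ → refl
  step (suc zero)    _   f a = f , (λ _ → subst (Bisected f a) (sym (+-comm a 1)) leaf) , λ _ → refl
  step (suc (suc δ)) rec f a = subst (Bisection f a) (⌊n/2⌋+⌈n/2⌉≡n (suc (suc δ)))
    (bisection-+ (s≤s z≤n) (⌊n/2⌋≤⌈n/2⌉ (suc (suc δ))) (⌈n/2⌉≤1+⌊n/2⌋ (suc (suc δ)))
      (rec (⌊n/2⌋<n (suc δ))) (rec (⌈n/2⌉<n δ)) f a)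
    where
    ⌈n/2⌉≤1+⌊n/2⌋ : ∀ n → ⌈ n /2⌉ ≤ suc ⌊ n /2⌋
    ⌈n/2⌉≤1+⌊n/2⌋ n = ⌊n/2⌋-mono (n≤1+n (suc n))

-- An end of the row is labelled with its distance from the first place `l`. On a side of length 0
-- the end is the first place itself, whence the guards.
record Row (f : ℕ → ℕ) (l r : ℕ) : Set where
  field
    first : f l ≡ suc (l + r)
    left  : 0 < l → f 0 ≡ l × Bisected f 0 l
    right : 0 < r → f (l + r) ≡ r × Bisected f l (l + r)

row : ∀ l r → ∃ λ f → Row f l r
row l r
  -- `const l` provides the label of place 0. The update at `l` is outermost, so it prevails where
  -- an end coincides with the first place.
  with (g , B , outB) ← bisection l ((const l [ l + r ≔ r ]) [ l ≔ suc (l + r) ]) 0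
  with (h , C , outC) ← bisection r g l = h , record
    { first = trans (outC (inj₁ ≤-refl)) (trans (outB (inj₂ ≤-refl))
        (≔-hit (const l [ l + r ≔ r ]) l (suc (l + r))))
    ; left  = λ 0<l →
        trans (outC (inj₁ z≤n)) (trans (outB (inj₁ z≤n)) (trans
          (≔-miss (const l [ l + r ≔ r ]) l (suc (l + r)) (<⇒≢ 0<l))
          (≔-miss (const l) (l + r) r (<⇒≢ (≤-trans 0<l (m≤m+n l r)))))) ,
        bisected-cong (λ _ x<l → sym (outC (inj₁ (<⇒≤ x<l)))) (B 0<l)
    ; right = λ 0<r →
        trans (outC (inj₂ ≤-refl)) (trans (outB (inj₂ (m≤m+n l r)))
          (trans (≔-miss (const l [ l + r ≔ r ]) l (suc (l + r)) (>⇒≢ (m<m+n l 0<r)))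
            (≔-hit (const l) (l + r) r))) ,
        C 0<r
    }

module _ {f l r} (R : Row f l r) where

  open Row R

  -- The pairs excepted by `bisected-separated` consist of the first place and an end, whose label
  -- is exactly their distance. For `x` and `y` on opposite sides, the label of `x` does not reach
  -- beyond `l`.
  row-separated : ∀ {x y} → x < y → y ≤ l + r → x + f x ≤ y ⊎ x + f y ≤ y
  row-separated {x} {y} x<y y≤l+r with y ≤? l | l ≤? x
  ... | yes y≤l | _ with (f0≡l , B) ← left (≤-trans (s≤s z≤n) (≤-trans x<y y≤l)) =
    [ id , (λ { (refl , refl) → inj₁ (≤-reflexive f0≡l) }) ]′ (bisected-separated B z≤n x<y y≤l)
  ... | no _ | yes l≤x
    with (fb≡r , C) ← right (+-cancelˡ-< l 0 r (≤-<-trans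
      (≤-trans (≤-reflexive (+-identityʳ l)) l≤x) (≤-trans x<y y≤l+r))) =
    [ id , (λ { (refl , refl) → inj₂ (≤-reflexive (cong (l +_) fb≡r)) }) ]′ (bisected-separated C l≤x x<y y≤l+r)
  row-separated {zero} {y} x<y y≤l+r | no y≰l | no l≰x
    with (f0≡l , _) ← left (≰⇒> l≰x) = inj₁ (≤-trans (≤-reflexive f0≡l) (<⇒≤ (≰⇒> y≰l)))
  row-separated {suc x} {y} x<y y≤l+r | no y≰l | no l≰x
    with (_ , B) ← left (≤-trans (s≤s z≤n) (≰⇒> l≰x)) =
    inj₁ (≤-trans (proj₂ (bisected-reach B (s≤s z≤n) (≰⇒> l≰x))) (<⇒≤ (≰⇒> y≰l)))

  -- A side longer than `q` has both ends labelled above `q`; on any other side the first place is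
  -- within `q`.
  row-dense : ∀ {q z} → q < suc (l + r) → z ≤ l + r → ∃ λ y → y ≤ l + r × q < f y × ∣ z - y ∣ ≤ q
  row-dense {q} {z} q<n z≤l+r with z ≤? l | q <? l | q <? r
  ... | yes z≤l | yes q<l | _
    with (f0≡l , B) ← left (≤-trans (s≤s z≤n) q<l)
    with (y , y≤l , p) ← bisected-dense B (subst (q <_) (sym f0≡l) q<l) (subst (q <_) (sym first) q<n) z≤n z≤l
    = y , ≤-trans y≤l (m≤m+n l r) , p
  ... | yes z≤l | no q≮l | _ =
    l , m≤m+n l r , subst (q <_) (sym first) q<n ,
    ∣-∣-≤ (m≤n⇒m≤n+o q z≤l) (≤-trans (≮⇒≥ q≮l) (m≤n+m q z))
  ... | no z≰l | _ | yes q<r with (fb≡r , C) ← right (≤-trans (s≤s z≤n) q<r) =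
    bisected-dense C (subst (q <_) (sym first) q<n) (subst (q <_) (sym fb≡r) q<r) (<⇒≤ (≰⇒> z≰l)) z≤l+r
  ... | no z≰l | _ | no q≮r =
    l , m≤m+n l r , subst (q <_) (sym first) q<n ,
    ∣-∣-≤ (≤-trans z≤l+r (+-monoʳ-≤ l (≮⇒≥ q≮r))) (m≤n⇒m≤n+o q (<⇒≤ (≰⇒> z≰l)))

  row-priority : Priority {suc (l + r)} (f ∘ toℕ)
  row-priority = record { separated = separated ; dense = dense }
    where
    close : ∀ {x y : Fin (suc (l + r))} {q} → toℕ x < toℕ y → q ≤ f (toℕ x) → q ≤ f (toℕ y) →
            q ≤ ∣ toℕ x - toℕ y ∣
    close {x} {y} {q} x<y q≤fx q≤fy = subst (q ≤_) (sym (m≤n⇒∣m-n∣≡n∸m (<⇒≤ x<y)))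
      (m+n≤o⇒m≤o∸n q (≤-trans (≤-reflexive (+-comm q (toℕ x)))
        ([ ≤-trans (+-monoʳ-≤ (toℕ x) q≤fx) , ≤-trans (+-monoʳ-≤ (toℕ x) q≤fy) ]′
           (row-separated x<y (toℕ≤pred[n] y)))))
    separated : ∀ {q} {x y : Fin (suc (l + r))} → x ≢ y → q ≤ f (toℕ x) → q ≤ f (toℕ y) →
                q ≤ ∣ toℕ x - toℕ y ∣
    separated {q} {x} {y} x≢y q≤fx q≤fy with <-cmp (toℕ x) (toℕ y)
    ... | tri< x<y _ _ = close x<y q≤fx q≤fy
    ... | tri≈ _ x≡y _ = contradiction (toℕ-injective x≡y) x≢y
    ... | tri> _ _ y<x = subst (q ≤_) (∣-∣-comm (toℕ y) (toℕ x)) (close y<x q≤fy q≤fx)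
    dense : ∀ {q} → q < suc (l + r) → (z : Fin (suc (l + r))) →
            ∃ λ y → q < f (toℕ y) × ∣ toℕ z - toℕ y ∣ ≤ q
    dense {q} q<n z = let (y , y≤ , q<fy , near) = row-dense q<n (toℕ≤pred[n] z) in
      fromℕ< (s≤s y≤) , subst (λ y → q < f y × ∣ toℕ z - y ∣ ≤ q) (sym (toℕ-fromℕ< (s≤s y≤))) (q<fy , near)

-- Multiplicities in a bisected gap

module _ (n : ℕ) (f : ℕ → ℕ) where

  Below : ℕ → ℕ → Fin n → Set
  Below q x y = toℕ y < x × f (toℕ y) ≡ q

  below? : ∀ q x → Decidable (Below q x)
  below? q x y = (toℕ y <? x) ×-dec (f (toℕ y) ≟ q)

  -- A prefix count: the interior of a gap from `a` to `b` contributes the increase of `rank q` from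
  -- `suc a` to `b`.
  rank : ℕ → ℕ → ℕ
  rank q x = count (below? q x) (allFin n)

  rank-mono : ∀ q {x y} → x ≤ y → rank q x ≤ rank q y
  rank-mono q {x} {y} x≤y = count-mono (below? q x) (below? q y) (allFin n)
    λ _ → map₁ (λ z<x → ≤-trans z<x x≤y)

  rank-suc : ∀ {x} → x < n → suc (rank (f x) x) ≤ rank (f x) (suc x)
  rank-suc {x} x<n = ≤-reflexive (sym (count-delete (below? (f x) (suc x)) (below? (f x) x)
    (allFin⁺ n) (∈-allFin (fromℕ< x<n))
    (subst (λ y → y < suc x × f y ≡ f x) (sym toℕ≡x) (≤-refl , refl))
    (λ (y<x , _) → <-irrefl toℕ≡x y<x)
    (map₁ (λ y<x → m≤n⇒m≤1+n y<x))
    (λ y≢x (y≤x , eq) → ≤∧≢⇒< (s≤s⁻¹ y≤x) (λ y≡x → y≢x (toℕ-injective (trans y≡x (sym toℕ≡x)))) , eq)))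
    where
    toℕ≡x : toℕ (fromℕ< x<n) ≡ x
    toℕ≡x = toℕ-fromℕ< x<n

  rank≤multiplicity : ∀ q x → rank q x ≤ multiplicity (f ∘ toℕ {n}) q
  rank≤multiplicity q x = count-mono (below? q x) (λ y → f (toℕ y) ≟ q) (allFin n) (λ _ → proj₂)

  -- Twice the number of interior ones is at least the length `b - a`, except in a gap of length 1.
  -- Subtractions are avoided by moving terms across.
  bisected-ones : ∀ {a b} → b ≤ n → Bisected f a b →
                  b ≡ suc a ⊎ 2 * rank 1 (suc a) + b ≤ 2 * rank 1 b + a
  bisected-ones b≤n leaf = inj₁ refl
  bisected-ones {a} {b} b≤n (node {m = m} k a+h≡m m+k≡b h≤k _ s t) = inj₂ bound
    where
    open ≤-Reasoning
    open +-*-Solver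
    m<n = <-≤-trans (bisected⇒< t) b≤n
    IHs = bisected-ones (<⇒≤ m<n) s
    IHt = bisected-ones b≤n t
    rₐ = rank 1 (suc a)
    rₘ = rank 1 m
    rₘ′ = rank 1 (suc m)
    r_b = rank 1 b
    -- A form that also covers gaps of length 1, at the price of 1 in the doubled count.
    loose : ∀ {c d} → d ≡ suc c ⊎ 2 * rank 1 (suc c) + d ≤ 2 * rank 1 d + c →
            2 * rank 1 (suc c) + d ≤ 2 * rank 1 d + suc c
    loose         (inj₁ refl) = ≤-refl
    loose {c} {d} (inj₂ le)   = ≤-trans le (+-monoʳ-≤ (2 * rank 1 d) (n≤1+n c))
    bound : 2 * rₐ + b ≤ 2 * r_b + a
    bound with f m ≟ 1
    -- Each half loses at most 1; the midpoint is itself a one and restores 2 to the doubled count.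
    ... | yes h≡1 = +-cancelʳ-≤ (2 + m + 2 * rₘ + 2 * rₘ′) _ _ (begin
      2 * rₐ + b + (2 + m + 2 * rₘ + 2 * rₘ′)
        ≡⟨ solve 5 (λ x b m y z → con 2 :* x :+ b :+ (con 2 :+ m :+ con 2 :* y :+ con 2 :* z) :=
             (con 2 :* x :+ m) :+ (con 2 :* (con 1 :+ y) :+ (con 2 :* z :+ b))) refl rₐ b m rₘ rₘ′ ⟩
      (2 * rₐ + m) + (2 * (1 + rₘ) + (2 * rₘ′ + b))
        ≤⟨ +-mono-≤ (loose IHs) (+-mono-≤ (*-monoʳ-≤ 2
             (subst (λ h → suc (rank h m) ≤ rank h (suc m)) h≡1 (rank-suc m<n))) (loose IHt)) ⟩
      (2 * rₘ + suc a) + (2 * rₘ′ + (2 * r_b + suc m))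
        ≡⟨ solve 5 (λ x a m y z → (con 2 :* y :+ (con 1 :+ a)) :+ (con 2 :* z :+ (con 2 :* x :+ (con 1 :+ m))) :=
             con 2 :* x :+ a :+ (con 2 :+ m :+ con 2 :* y :+ con 2 :* z)) refl r_b a m rₘ rₘ′ ⟩
      2 * r_b + a + (2 + m + 2 * rₘ + 2 * rₘ′) ∎)
    ... | no h≢1 = combine IHs IHt
      where
      combine : m ≡ suc a ⊎ 2 * rₐ + m ≤ 2 * rₘ + a → b ≡ suc m ⊎ 2 * rₘ′ + b ≤ 2 * r_b + m →
                2 * rₐ + b ≤ 2 * r_b + a
      -- A half of length 1 would force the midpoint label to be 1, so the induction hypotheses hold
      -- for both halves without loss.
      combine (inj₁ m≡1+a) _ = contradiction
        (+-cancelˡ-≡ a (f m) 1 (trans a+h≡m (trans m≡1+a (sym (+-comm a 1))))) h≢1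
      combine (inj₂ _) (inj₁ b≡1+m) = contradiction (≤-antisym
        (≤-trans h≤k (≤-reflexive (+-cancelˡ-≡ m k 1 (trans m+k≡b (trans b≡1+m (sym (+-comm m 1)))))))
        (+-cancelˡ-≤ a 1 (f m) (≤-trans (≤-reflexive (+-comm a 1))
          (≤-trans (bisected⇒< s) (≤-reflexive (sym a+h≡m)))))) h≢1
      combine (inj₂ p) (inj₂ q) = +-cancelʳ-≤ (m + 2 * rₘ) _ _ (begin
        2 * rₐ + b + (m + 2 * rₘ)
          ≡⟨ solve 4 (λ x b m y → con 2 :* x :+ b :+ (m :+ con 2 :* y) :=
               (con 2 :* x :+ m) :+ (con 2 :* y :+ b)) refl rₐ b m rₘ ⟩
        (2 * rₐ + m) + (2 * rₘ + b)
          ≤⟨ +-mono-≤ p (≤-trans (+-monoˡ-≤ b (*-monoʳ-≤ 2 (rank-mono 1 (n≤1+n m)))) q) ⟩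
        (2 * rₘ + a) + (2 * r_b + m)
          ≡⟨ solve 4 (λ x a m y → (con 2 :* y :+ a) :+ (con 2 :* x :+ m) :=
               con 2 :* x :+ a :+ (m :+ con 2 :* y)) refl r_b a m rₘ ⟩
        2 * r_b + a + (m + 2 * rₘ) ∎)

  ranks : ℕ → ℕ → ℕ
  ranks q x = rank q x + rank (suc q) x

  ranks-mono : ∀ q {x y} → x ≤ y → ranks q x ≤ ranks q y
  ranks-mono q x≤y = +-mono-≤ (rank-mono q x≤y) (rank-mono (suc q) x≤y)

  ranks-suc : ∀ {q x} → x < n → q ≤ f x → f x ≤ suc q → suc (ranks q x) ≤ ranks q (suc x)
  ranks-suc {q} {x} x<n q≤fx fx≤1+q with m≤n⇒m<n∨m≡n q≤fx
  ... | inj₂ refl = +-mono-≤ (rank-suc x<n) (rank-mono (suc (f x)) (n≤1+n x))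
  ... | inj₁ q<fx = ≤-trans (≤-reflexive (sym (+-suc _ _))) (+-mono-≤ (rank-mono q (n≤1+n x))
    (subst (λ p → suc (rank p x) ≤ rank p (suc x)) (≤-antisym fx≤1+q q<fx) (rank-suc x<n)))

  bisected-level : ∀ j {q a b} → 1 ≤ q → b ≤ n → Bisected f a b →
    2 ^ suc j * q + a ≤ b → b ≤ 2 ^ suc j * suc q + a → ranks q (suc a) + 2 ^ j ≤ ranks q b
  bisected-level j {suc q} {a} _ b≤n leaf lo hi =
    contradiction lo (<⇒≱ (+-monoˡ-≤ a (*-mono-≤ (m≤m*n 2 (2 ^ j) {{m^n≢0 2 j}}) (s≤s (z≤n {q})))))
  bisected-level j {q} {a} {b} 1≤q b≤n (node {m = m} k a+h≡m m+k≡b h≤k k≤1+h s t) lo hi = bound j lo hi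
    where
    open ≤-Reasoning
    open +-*-Solver
    h = f m
    m<n = <-≤-trans (bisected⇒< t) b≤n
    b≡h+k+a : b ≡ h + k + a
    b≡h+k+a = trans (sym m+k≡b) (trans (cong (_+ k) (sym a+h≡m))
      (solve 3 (λ a h k → a :+ h :+ k := h :+ k :+ a) refl a h k))
    -- Parity absorbs the unequal halves: `2 * x` is at most `2 * h + 1`, hence `x` is at most `h`.
    half-lo : ∀ x → 2 * x + a ≤ b → x ≤ h
    half-lo x le = s≤s⁻¹ (*-cancelˡ-< 2 x (suc h) (s≤s (begin
      2 * x ≤⟨ +-cancelʳ-≤ a _ _ (≤-trans le (≤-reflexive b≡h+k+a)) ⟩
      h + k ≤⟨ +-monoʳ-≤ h k≤1+h ⟩
      h + suc h ≡⟨ cong (λ x → h + suc x) (+-identityʳ h) ⟨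
      h + suc (h + 0) ∎)))
    half-hi : ∀ x → b ≤ 2 * x + a → k ≤ x
    half-hi x le = s≤s⁻¹ (*-cancelˡ-< 2 k (suc x) (begin-strict
      2 * k             ≡⟨ cong (k +_) (+-identityʳ k) ⟩
      k + k             ≤⟨ +-monoˡ-≤ k k≤1+h ⟩
      suc (h + k)       ≤⟨ s≤s (+-cancelʳ-≤ a _ _ (≤-trans (≤-reflexive (sym b≡h+k+a)) le)) ⟩
      suc (2 * x)       <⟨ ≤-reflexive (solve 1 (λ x → con 2 :+ con 2 :* x := con 2 :* (con 1 :+ x)) refl x) ⟩
      2 * suc x         ∎))
    bound : ∀ j → 2 ^ suc j * q + a ≤ b → b ≤ 2 ^ suc j * suc q + a → ranks q (suc a) + 2 ^ j ≤ ranks q b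
    bound zero lo hi = begin
      ranks q (suc a) + 1 ≡⟨ +-comm _ 1 ⟩
      suc (ranks q (suc a)) ≤⟨ s≤s (ranks-mono q (bisected⇒< s)) ⟩
      suc (ranks q m)     ≤⟨ ranks-suc m<n (half-lo q lo) (≤-trans h≤k (half-hi (suc q) hi)) ⟩
      ranks q (suc m)     ≤⟨ ranks-mono q (bisected⇒< t) ⟩
      ranks q b ∎
    bound (suc j) lo hi = begin
      ranks q (suc a) + 2 ^ suc j
        ≡⟨ solve 2 (λ r p → r :+ con 2 :* p := r :+ p :+ p) refl (ranks q (suc a)) (2 ^ j) ⟩
      ranks q (suc a) + 2 ^ j + 2 ^ j
        ≤⟨ +-monoˡ-≤ (2 ^ j) (bisected-level j 1≤q (<⇒≤ m<n) s
             (≤-trans (+-monoˡ-≤ a lo′) (≤-reflexive (trans (+-comm h a) a+h≡m)))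
             (≤-trans (≤-reflexive (trans (sym a+h≡m) (+-comm a h))) (+-monoˡ-≤ a (≤-trans h≤k hi′)))) ⟩
      ranks q m + 2 ^ j ≤⟨ +-monoˡ-≤ (2 ^ j) (ranks-mono q (n≤1+n m)) ⟩
      ranks q (suc m) + 2 ^ j
        ≤⟨ bisected-level j 1≤q b≤n t
             (≤-trans (+-monoˡ-≤ m (≤-trans lo′ h≤k)) (≤-reflexive (trans (+-comm k m) m+k≡b)))
             (≤-trans (≤-reflexive (trans (sym m+k≡b) (+-comm m k))) (+-monoˡ-≤ m hi′)) ⟩
      ranks q b ∎
      where
      lo′ : 2 ^ suc j * q ≤ h
      lo′ = half-lo _ (≤-trans (≤-reflexive (cong (_+ a) (sym (*-assoc 2 (2 ^ suc j) q)))) lo)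
      hi′ : k ≤ 2 ^ suc j * suc q
      hi′ = half-hi _ (≤-trans hi (≤-reflexive (cong (_+ a) (*-assoc 2 (2 ^ suc j) (suc q)))))

-- Comparison with the product and summation over the first place

!-mono-≤ : ∀ {m n} → m ≤ n → m ! ≤ n !
!-mono-≤ {n = n} z≤n = 1≤n! n
!-mono-≤ (s≤s m≤n)   = *-mono-≤ (s≤s m≤n) (!-mono-≤ m≤n)

2*⌊n/2⌋≤n : ∀ n → 2 * ⌊ n /2⌋ ≤ n
2*⌊n/2⌋≤n n = begin
  2 * ⌊ n /2⌋         ≡⟨ cong (_+_ ⌊ n /2⌋) (+-identityʳ _) ⟩
  ⌊ n /2⌋ + ⌊ n /2⌋   ≤⟨ +-monoʳ-≤ ⌊ n /2⌋ (⌊n/2⌋≤⌈n/2⌉ n) ⟩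
  ⌊ n /2⌋ + ⌈ n /2⌉   ≡⟨ ⌊n/2⌋+⌈n/2⌉≡n n ⟩
  n                   ∎
  where open ≤-Reasoning

n<2*[1+⌊n/2⌋] : ∀ n → n < 2 * suc ⌊ n /2⌋
n<2*[1+⌊n/2⌋] n = begin-strict
  n                          ≡⟨ ⌊n/2⌋+⌈n/2⌉≡n n ⟨
  ⌊ n /2⌋ + ⌈ n /2⌉          <⟨ +-mono-<-≤ (n<1+n ⌊ n /2⌋) (⌊n/2⌋-mono (n≤1+n (suc n))) ⟩
  suc ⌊ n /2⌋ + suc ⌊ n /2⌋  ≡⟨ cong (_+_ (suc ⌊ n /2⌋)) (+-identityʳ _) ⟨
  2 * suc ⌊ n /2⌋            ∎
  where open ≤-Reasoning

2*m≤n⇒m≤⌊n/2⌋ : ∀ {m n} → 2 * m ≤ n → m ≤ ⌊ n /2⌋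
2*m≤n⇒m≤⌊n/2⌋ {m} {n} le = s≤s⁻¹ (*-cancelˡ-< 2 m (suc ⌊ n /2⌋) (≤-<-trans le (n<2*[1+⌊n/2⌋] n)))

2^⌊log₂n⌋≤n : ∀ n → 1 ≤ n → 2 ^ ⌊log₂ n ⌋ ≤ n
2^⌊log₂n⌋≤n = <-rec _ step
  where
  open ≤-Reasoning
  step : ∀ n → (∀ {m} → m < n → 1 ≤ m → 2 ^ ⌊log₂ m ⌋ ≤ m) → 1 ≤ n → 2 ^ ⌊log₂ n ⌋ ≤ n
  step (suc zero)    rec _ = ≤-refl
  step (suc (suc n)) rec _ = begin
    2 ^ ⌊log₂ 2 + n ⌋             ≤⟨ ^-monoʳ-≤ 2 (m≤n+m∸n ⌊log₂ 2 + n ⌋ 1) ⟩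
    2 ^ suc (⌊log₂ 2 + n ⌋ ∸ 1)   ≡⟨ cong (λ k → 2 ^ suc k) (⌊log₂⌊n/2⌋⌋≡⌊log₂n⌋∸1 (2 + n)) ⟨
    2 * 2 ^ ⌊log₂ ⌊ 2 + n /2⌋ ⌋   ≤⟨ *-monoʳ-≤ 2 (rec (⌊n/2⌋<n (suc n)) (s≤s z≤n)) ⟩
    2 * ⌊ 2 + n /2⌋               ≤⟨ 2*⌊n/2⌋≤n (2 + n) ⟩
    2 + n                         ∎

Levels : (ℕ → ℕ) → ℕ → Set
Levels N d = ∀ j q → 1 ≤ q → 2 ^ suc j * q ≤ d → d ≤ 2 ^ suc j * suc q → 2 ^ j ≤ N q + N (suc q)

-- The term of the theorem's sum, with `d` for `i ∸ 1` and `e` for `n ∸ i`.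
summand : ℕ → ℕ → ℕ
summand d e = (⌊ d /2⌋ + ⌊ e /2⌋) ! * (∏[1⋯ ⌊log₂ d /4⌋ ] λ j → (2 ^ (j ∸ 1)) !)

module _ (N : ℕ → ℕ) where

  open ≤-Reasoning

  orderings-suc : ∀ q → orderings N q ≤ orderings N (suc q)
  orderings-suc q = m≤n*m (orderings N q) (N q !) {{ N q !≢0 }}

  orderings-mono : ∀ {p q} → p ≤ q → orderings N p ≤ orderings N q
  orderings-mono {zero}  {zero}  _ = ≤-refl
  orderings-mono {p} {suc q} p≤1+q with m≤n⇒m<n∨m≡n p≤1+q
  ... | inj₂ refl  = ≤-refl
  ... | inj₁ p<1+q = ≤-trans (orderings-mono (s≤s⁻¹ p<1+q)) (orderings-suc q)

  orderings-! : ∀ {k q} → k ≤ N q → k ! * orderings N q ≤ orderings N (suc q)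
  orderings-! k≤N = *-monoˡ-≤ _ (!-mono-≤ k≤N)

  -- Pigeonhole: one of the levels `q` and `suc q` has at least `k` places and supplies `k !`, while
  -- the factorial of the other is at least 1.
  orderings-two : ∀ {k q} → 2 * k ≤ N q + N (suc q) → k ! * orderings N q ≤ orderings N (2 + q)
  orderings-two {k} {q} 2k≤ with k ≤? N q | k ≤? N (suc q)
  ... | yes k≤N | _       = ≤-trans (orderings-! k≤N) (orderings-suc (suc q))
  ... | no _    | yes k≤N = ≤-trans (*-monoʳ-≤ (k !) (orderings-suc q)) (orderings-! k≤N)
  ... | no k≰N  | no k≰N′ = contradiction 2k≤
    (<⇒≱ (<-≤-trans (+-mono-< (≰⇒> k≰N) (≰⇒> k≰N′)) (≤-reflexive (cong (k +_) (sym (+-identityʳ k))))))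

  ones≤orderings : ∀ {q} → 2 ≤ q → N 1 ! ≤ orderings N q
  ones≤orderings 2≤q = ≤-trans (m≤m*n (N 1 !) (N 0 ! * 1) {{ m*n≢0 (N 0 !) 1 {{ N 0 !≢0 }} }}) (orderings-mono 2≤q)

  module _ {d} (levels : Levels N d) where

    -- The levels `q` and `suc q` pay for the factor `g 0`, and the remaining factors are paid for
    -- below `q`, starting from `⌊ q /2⌋` one halving deeper. The bound `2 ^ s ≤ q` keeps these
    -- pairs of levels disjoint and above level 1, which pays for `N 1 !`.
    product≤orderings : ∀ s j q (g : ℕ → ℕ) → (∀ t → g t ≤ (2 ^ (t + j)) !) → 2 ^ s ≤ q →
      2 ^ (2 + j) * q ≤ d → d ≤ 2 ^ (2 + j) * suc q →
      N 1 ! * product (applyUpTo g s) ≤ orderings N (2 + q)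
    product≤orderings zero j q g g≤ s≤ lo hi =
      ≤-trans (≤-reflexive (*-identityʳ _)) (ones≤orderings (s≤s (s≤s z≤n)))
    product≤orderings (suc s) j q g g≤ s≤ lo hi = begin
      N 1 ! * (g 0 * product (applyUpTo (g ∘ suc) s))
        ≡⟨ solve 3 (λ a b c → a :* (b :* c) := b :* (a :* c)) refl (N 1 !) (g 0) _ ⟩
      g 0 * (N 1 ! * product (applyUpTo (g ∘ suc) s))
        ≤⟨ *-mono-≤ (g≤ 0) (rest s s≤) ⟩
      (2 ^ j) ! * orderings N q
        ≤⟨ orderings-two {2 ^ j} (levels (suc j) q (≤-trans (m^n>0 2 (suc s)) s≤) lo hi) ⟩
      orderings N (2 + q) ∎
      where
      open +-*-Solver
      h = ⌊ q /2⌋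
      rest : ∀ s → 2 ^ suc s ≤ q → N 1 ! * product (applyUpTo (g ∘ suc) s) ≤ orderings N q
      rest zero      2≤q = ≤-trans (≤-reflexive (*-identityʳ _)) (ones≤orderings 2≤q)
      rest s@(suc s′) s≤ = ≤-trans
        (product≤orderings s (suc j) h (g ∘ suc)
          (λ t → ≤-trans (g≤ (suc t)) (≤-reflexive (cong (λ k → (2 ^ k) !) (sym (+-suc t j)))))
          2^s≤h
          (≤-trans (≤-reflexive (double h)) (≤-trans (*-monoʳ-≤ (2 ^ (2 + j)) (2*⌊n/2⌋≤n q)) lo))
          (≤-trans hi (≤-trans (*-monoʳ-≤ (2 ^ (2 + j)) (n<2*[1+⌊n/2⌋] q)) (≤-reflexive (sym (double (suc h)))))))
        -- The next pair `h`, `suc h` lies below `q` because `h` is at least 2; this uses that a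
        -- factor remains.
        (orderings-mono (begin
          2 + h ≤⟨ +-monoˡ-≤ h (≤-trans (*-monoʳ-≤ 2 (m^n>0 2 s′)) 2^s≤h) ⟩
          h + h ≡⟨ cong (h +_) (+-identityʳ h) ⟨
          2 * h ≤⟨ 2*⌊n/2⌋≤n q ⟩
          q     ∎))
        where
        2^s≤h = 2*m≤n⇒m≤⌊n/2⌋ s≤
        double : ∀ x → 2 ^ (3 + j) * x ≡ 2 ^ (2 + j) * (2 * x)
        double x = solve 2 (λ p x → (con 2 :* p) :* x := p :* (con 2 :* x)) refl (2 ^ (2 + j)) x

    summand≤orderings : ∀ {e n} → 2 ≤ n → d < n → ⌊ d /2⌋ + ⌊ e /2⌋ ≤ N 1 → summand d e ≤ orderings N n
    summand≤orderings {e} {n} 2≤n d<n ones =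
      ≤-trans (*-monoˡ-≤ _ (!-mono-≤ ones)) (bound ⌊log₂ d ⌋ λ 2≤L → 2^⌊log₂n⌋≤n d (positive d 2≤L))
      where
      positive : ∀ d → 2 ≤ ⌊log₂ d ⌋ → 1 ≤ d
      positive (suc d) _ = s≤s z≤n
      empty : N 1 ! * 1 ≤ orderings N n
      empty = ≤-trans (≤-reflexive (*-identityʳ _)) (ones≤orderings 2≤n)
      -- With the logarithm generalised to `L`, the integer `L - 2` computes by cases. The values 0
      -- and 1, including the default `⌊log₂ 0 ⌋ = 0`, give the empty product.
      bound : ∀ L → (2 ≤ L → 2 ^ L ≤ d) →
              N 1 ! * (∏[1⋯ ℤ.+ L ℤ.- ℤ.+ 2 ] λ j → (2 ^ (j ∸ 1)) !) ≤ orderings N n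
      bound zero          _    = empty
      bound (suc zero)    _    = empty
      bound (suc (suc s)) 2^L≤ = begin
        N 1 ! * product (map (λ j → (2 ^ (j ∸ 1)) !) (applyUpTo suc s))
          ≡⟨ cong (λ xs → N 1 ! * product xs) (map-applyUpTo suc _ s) ⟩
        N 1 ! * product (applyUpTo (λ t → (2 ^ t) !) s)
          ≤⟨ product≤orderings s 0 q _ (λ t → ≤-reflexive (cong (λ k → (2 ^ k) !) (sym (+-identityʳ t))))
               2^s≤q 4q≤d d≤4q+4 ⟩
        orderings N (2 + q) ≤⟨ orderings-mono 2+q≤n ⟩
        orderings N n ∎
        where
        h = ⌊ d /2⌋
        q = ⌊ h /2⌋
        2^s≤q : 2 ^ s ≤ q
        2^s≤q = 2*m≤n⇒m≤⌊n/2⌋ (2*m≤n⇒m≤⌊n/2⌋ (2^L≤ (s≤s (s≤s z≤n))))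
        4q≤d : 4 * q ≤ d
        4q≤d = begin
          4 * q ≡⟨ *-assoc 2 2 q ⟩
          2 * (2 * q) ≤⟨ *-monoʳ-≤ 2 (2*⌊n/2⌋≤n h) ⟩
          2 * h ≤⟨ 2*⌊n/2⌋≤n d ⟩
          d ∎
        d≤4q+4 : d ≤ 4 * suc q
        d≤4q+4 = begin
          d ≤⟨ <⇒≤ (n<2*[1+⌊n/2⌋] d) ⟩
          2 * suc h ≤⟨ *-monoʳ-≤ 2 (n<2*[1+⌊n/2⌋] h) ⟩
          2 * (2 * suc q) ≡⟨ *-assoc 2 2 (suc q) ⟨
          4 * suc q ∎
        2+q≤n : 2 + q ≤ n
        2+q≤n = begin
          2 + q       ≤⟨ s≤s (+-monoˡ-≤ q (≤-trans (m^n>0 2 s) 2^s≤q)) ⟩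
          suc (q + q) ≤⟨ s≤s (+-monoʳ-≤ q (m≤m+n q _)) ⟩
          suc (4 * q) ≤⟨ s≤s 4q≤d ⟩
          suc d       ≤⟨ d<n ⟩
          n           ∎

module _ {n f a δ} (B : 0 < δ → Bisected f a (a + δ)) (b≤n : a + δ ≤ n) where

  -- Prefix counts let the two sides of the row be chained at the first place. Lengths 0 and 1 ask
  -- for no ones, which removes the exception in `bisected-ones`.
  segment-ones : ⌊ δ /2⌋ + rank n f 1 a ≤ rank n f 1 (a + δ)
  segment-ones with δ ≟ 0
  ... | yes refl = ≤-reflexive (cong (rank n f 1) (sym (+-identityʳ a)))
  ... | no δ≢0 with bisected-ones n f b≤n (B (n≢0⇒n>0 δ≢0))
  ...   | inj₁ eq with refl ← +-cancelˡ-≡ a δ 1 (trans eq (+-comm 1 a)) =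
    rank-mono n f 1 (m≤m+n a 1)
  ...   | inj₂ le = *-cancelˡ-≤ 2 (+-cancelʳ-≤ a _ _ (begin
    2 * (⌊ δ /2⌋ + rank n f 1 a) + a
      ≡⟨ solve 3 (λ h r a → con 2 :* (h :+ r) :+ a := con 2 :* r :+ (a :+ con 2 :* h)) refl ⌊ δ /2⌋ (rank n f 1 a) a ⟩
    2 * rank n f 1 a + (a + 2 * ⌊ δ /2⌋)
      ≤⟨ +-mono-≤ (*-monoʳ-≤ 2 (rank-mono n f 1 (n≤1+n a))) (+-monoʳ-≤ a (2*⌊n/2⌋≤n δ)) ⟩
    2 * rank n f 1 (suc a) + (a + δ) ≤⟨ le ⟩
    2 * rank n f 1 (a + δ) + a ∎))
    where
    open ≤-Reasoning
    open +-*-Solver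

  segment-levels : Levels (multiplicity (f ∘ toℕ {n})) δ
  segment-levels j q 1≤q lo hi = begin
    2 ^ j                              ≤⟨ m≤n+m (2 ^ j) _ ⟩
    ranks n f q (suc a) + 2 ^ j        ≤⟨ bisected-level n f j 1≤q b≤n
                                            (B (≤-trans (*-mono-≤ (m^n>0 2 (suc j)) 1≤q) lo))
                                            (≤-trans (+-monoˡ-≤ a lo) (≤-reflexive (+-comm δ a)))
                                            (≤-trans (≤-reflexive (+-comm a δ)) (+-monoˡ-≤ a hi)) ⟩
    ranks n f q (a + δ)                ≤⟨ +-mono-≤ (rank≤multiplicity n f q (a + δ))
                                           (rank≤multiplicity n f (suc q) (a + δ)) ⟩
    multiplicity (f ∘ toℕ {n}) q + multiplicity (f ∘ toℕ {n}) (suc q) ∎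
    where open ≤-Reasoning

-- The ones of both sides are counted together, whereas the product may be drawn from the halving of
-- either side; hence the maximum.
summand≤continuations : ∀ {l r m} → l + r ≡ m → 1 ≤ m → (p : Fin (suc m)) → toℕ p ≡ l →
                     summand l r ⊔ summand r l ≤ continuations [ p ] m
summand≤continuations {l} {r} refl 1≤m p p≡l with (f , R) ← row l r = ≤-trans
  (⊔-lub
    (summand≤orderings N (segment-levels (proj₂ ∘ left) l≤n) {r} (s≤s 1≤m) (s≤s (m≤m+n l r)) ones)
    (summand≤orderings N (segment-levels (proj₂ ∘ right) b≤n) {l} (s≤s 1≤m) (s≤s (m≤n+m r l))
      (≤-trans (≤-reflexive (+-comm ⌊ r /2⌋ ⌊ l /2⌋)) ones)))
  (orderings≤continuations (f ∘ toℕ) (row-priority R) (trans (cong f p≡l) first))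
  where
  open Row R
  open ≤-Reasoning
  N = multiplicity (f ∘ toℕ {suc (l + r)})
  b≤n : l + r ≤ suc (l + r)
  b≤n = n≤1+n (l + r)
  l≤n : l ≤ suc (l + r)
  l≤n = ≤-trans (m≤m+n l r) b≤n
  rk = rank (suc (l + r)) f 1
  ones : ⌊ l /2⌋ + ⌊ r /2⌋ ≤ N 1
  ones = begin
    ⌊ l /2⌋ + ⌊ r /2⌋         ≡⟨ +-comm ⌊ l /2⌋ ⌊ r /2⌋ ⟩
    ⌊ r /2⌋ + ⌊ l /2⌋         ≤⟨ +-monoʳ-≤ ⌊ r /2⌋ (m≤m+n ⌊ l /2⌋ (rk 0)) ⟩
    ⌊ r /2⌋ + (⌊ l /2⌋ + rk 0) ≤⟨ +-monoʳ-≤ ⌊ r /2⌋ (segment-ones (proj₂ ∘ left) l≤n) ⟩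
    ⌊ r /2⌋ + rk l            ≤⟨ segment-ones (proj₂ ∘ right) b≤n ⟩
    rk (l + r)                ≤⟨ rank≤multiplicity (suc (l + r)) f 1 (l + r) ⟩
    N 1                       ∎

sum-applyUpTo-+ : ∀ f m n →
  sum (applyUpTo f (m + n)) ≡ sum (applyUpTo f m) + sum (applyUpTo (λ k → f (m + k)) n)
sum-applyUpTo-+ f zero    n = refl
sum-applyUpTo-+ f (suc m) n =
  trans (cong (f 0 +_) (sum-applyUpTo-+ (f ∘ suc) m n)) (sym (+-assoc (f 0) _ _))

sum-applyUpTo-mono : ∀ {f g} n → (∀ k → k < n → f k ≤ g k) → sum (applyUpTo f n) ≤ sum (applyUpTo g n)
sum-applyUpTo-mono zero    f≤g = z≤n
sum-applyUpTo-mono (suc n) f≤g = +-mono-≤ (f≤g 0 (s≤s z≤n)) (sum-applyUpTo-mono n (λ k → f≤g (suc k) ∘ s≤s))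

sum-applyUpTo-reverse : ∀ f n → sum (applyUpTo (λ k → f (n ∸ suc k)) n) ≡ sum (applyUpTo f n)
sum-applyUpTo-reverse f n = begin
  sum (applyUpTo (λ k → f (n ∸ suc k)) n) ≡⟨ cong sum (downFrom n) ⟩
  sum (applyDownFrom f n)                 ≡⟨ cong sum (reverse-applyUpTo f n) ⟨
  sum (reverse (applyUpTo f n))           ≡⟨ sum-↭ (↭-reverse (applyUpTo f n)) ⟩
  sum (applyUpTo f n)                     ∎
  where
  open ≡-Reasoning
  downFrom : ∀ n → applyUpTo (λ k → f (n ∸ suc k)) n ≡ applyDownFrom f n
  downFrom zero    = refl
  downFrom (suc n) = cong (f n ∷_) (downFrom n)

sum-tabulate-≥ : ∀ {n} (h : ℕ → ℕ) (F : Fin n → ℕ) → (∀ x → h (toℕ x) ≤ F x) →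
                 sum (applyUpTo h n) ≤ sum (tabulate F)
sum-tabulate-≥ {zero}  h F h≤F = z≤n
sum-tabulate-≥ {suc n} h F h≤F =
  +-mono-≤ (h≤F Fin.zero) (sum-tabulate-≥ (h ∘ suc) (F ∘ Fin.suc) (h≤F ∘ Fin.suc))

mainTheorem2 : (n : ℕ) → 2 ≤ n →
    2 * (∑[ suc ⌈ n /2⌉ ⋯ n ] λ i →
    (⌊ (i ∸ 1) /2⌋ + ⌊ (n ∸ i) /2⌋) !
    * (∏[1⋯ ⌊log₂ (i ∸ 1) /4⌋ ] λ j → (2 ^ (j ∸ 1)) !))
    ≤ a n
mainTheorem2 n@(suc m) (s≤s 1≤m) = begin
  2 * sum (map (λ i → summand (i ∸ 1) (n ∸ i)) (applyUpTo (λ k → suc c + k) (n ∸ c)))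
    ≡⟨ cong (λ xs → 2 * sum xs) (map-applyUpTo (λ k → suc c + k) _ (n ∸ c)) ⟩
  2 * sum (applyUpTo t (n ∸ c))
    ≡⟨ cong (λ u → 2 * sum (applyUpTo t u)) (trans (cong (_∸ c) (sym c+u≡n)) (m+n∸m≡n c u)) ⟩
  2 * sum (applyUpTo t u)
    ≡⟨ cong (S +_) (+-identityʳ S) ⟩
  S + S
    -- The last `u` places yield one copy of `S` directly, the first `c` places the other copy by
    -- reflection.
    ≤⟨ +-mono-≤ upper lower ⟩
  sum (applyUpTo h c) + sum (applyUpTo (λ k → h (c + k)) u)
    ≡⟨ sum-applyUpTo-+ h c u ⟨
  sum (applyUpTo h (c + u))
    ≡⟨ cong (λ n → sum (applyUpTo h n)) c+u≡n ⟩
  sum (applyUpTo h n)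
    ≤⟨ sum-tabulate-≥ h (λ p → continuations [ p ] m) (λ p →
         summand≤continuations (m+[n∸m]≡n (toℕ≤pred[n] p)) 1≤m p refl) ⟩
  sum (tabulate (λ p → continuations [ p ] m))
    ≡⟨ cong sum (map-tabulate id (λ p → continuations [ p ] m)) ⟨
  sum (map (λ p → continuations [ p ] m) (allFin n))
    ≡⟨ count-cartesianProductWith polite? _∷_ (allFin n) (sequences n m) ⟨
  a n ∎
  where
  open ≤-Reasoning
  c = ⌈ n /2⌉
  u = ⌊ n /2⌋
  h t : ℕ → ℕ
  h p = summand p (m ∸ p) ⊔ summand (m ∸ p) p
  t k = summand (c + k) (m ∸ (c + k))
  S = sum (applyUpTo t u)
  c+u≡n : c + u ≡ n
  c+u≡n = trans (+-comm c u) (⌊n/2⌋+⌈n/2⌉≡n n)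
  lower : S ≤ sum (applyUpTo (λ k → h (c + k)) u)
  lower = sum-applyUpTo-mono u (λ k _ → m≤m⊔n _ _)
  upper : S ≤ sum (applyUpTo h c)
  upper = begin
    S ≤⟨ sum-applyUpTo-mono u mirror ⟩
    sum (applyUpTo (λ k → h (u ∸ suc k)) u) ≡⟨ sum-applyUpTo-reverse h u ⟩
    -- For odd `n` the middle place is left out of the count here.
    sum (applyUpTo h u) ≤⟨ m≤m+n _ _ ⟩
    sum (applyUpTo h u) + sum (applyUpTo (λ k → h (u + k)) (c ∸ u)) ≡⟨ sum-applyUpTo-+ h u (c ∸ u) ⟨
    sum (applyUpTo h (u + (c ∸ u))) ≡⟨ cong (λ k → sum (applyUpTo h k)) (m+[n∸m]≡n (⌊n/2⌋≤⌈n/2⌉ n)) ⟩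
    sum (applyUpTo h c) ∎
    where
    -- The reflection of place `c + k` is `m ∸ (c + k)`, which equals `u ∸ suc k`; it exchanges the
    -- two arguments of `summand`.
    mirror : ∀ k → k < u → t k ≤ h (u ∸ suc k)
    mirror k k<u = ≤-trans (≤-reflexive (cong₂ summand l≡ r≡)) (m≤n⊔m _ _)
      where
      x = u ∸ suc k
      m≡ : m ≡ x + (c + k)
      m≡ = suc-injective (trans (sym c+u≡n) (trans (cong (c +_) (sym (m∸n+n≡m k<u)))
        (solve 3 (λ c x k → c :+ (x :+ (con 1 :+ k)) := con 1 :+ (x :+ (c :+ k))) refl c x k)))
        where open +-*-Solver
      l≡ : c + k ≡ m ∸ x
      l≡ = sym (trans (cong (_∸ x) m≡) (m+n∸m≡n x (c + k)))
      r≡ : m ∸ (c + k) ≡ x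
      r≡ = trans (cong (_∸ (c + k)) m≡) (m+n∸n≡m x (c + k))
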